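{- For any graphs $G$ and $H$, $$\rho_e^o(G\times H)\ge \max\bigl\{\rho_e^o(G)\,\delta(H)\,\rho^o(H),\ \rho_e^o(H)\,\delta(G)\,\rho^o(G)\bigr\}.$$ Moreover, this bound is sharp, that is, there exist graphs $G$ and $H$ for which equality holds.
   Context: All graphs are finite and simple. A set $B\subseteq E(G)$ is an edge open packing set (EOP set) of $G$ if for any two distinct edges $e_1,e_2\in B$ there is no edge $e\in E(G)\setminus\{e_1,e_2\}$ joining an endvertex of $e_1$ to an endvertex of $e_2$ (that is, no edge $e$ such that $e_1,e,e_2$ form a path with middle edge $e$ or a triangle). Edges of $B$ may share an endvertex. The maximum cardinality of an EOP set is the EOP number $\rho_e^o(G)$. $\delta(G)$ is the minimum degree of $G$. A set $P\subseteq V(G)$ is an open packing if $N(u)\cap N(v)=\emptyset$ for any distinct $u,v\in P$, where $N(u)$ is the open neighborhood of $u$; the open packing number $\rho^o(G)$ is the maximum cardinality of an open packing in $G$. The direct product $G\times H$ has vertex set $V(G)\times V(H)$, and $(g,h)$, $(g',h')$ are adjacent if $gg'\in E(G)$ and $hh'\in E(H)$. -}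

module Defs where

open import Data.Fin as Fin using (Fin)
import Data.Fin.Properties as Fin
open import Data.List using (List; []; _∷_; _++_; map; filter; length; allFin; cartesianProduct)
open import Data.List.Extrema.Nat using (max; min)
open import Data.List.Membership.Propositional using (_∈_)
open import Data.List.Relation.Binary.Disjoint.Propositional using (Disjoint)
import Data.List.Relation.Binary.Disjoint.DecPropositional as DecDisjoint
open import Data.List.Relation.Unary.All using (All; all?; lookup; tabulate)
open import Data.Nat using (ℕ; _*_)
open import Data.Product using (_×_; _,_)
open import Data.Product.Function.NonDependent.Propositional using (_×-↔_)
open import Data.Product.Properties using (≡-dec)
open import Data.Sum using (_⊎_)
open import Function using (_↔_; Inverse)
open import Function.Construct.Composition using (_↔-∘_)
open import Function.Construct.Symmetry using (↔-sym)
open import Function.Properties.Inverse using (↔⇒↣)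
open import Relation.Binary.Definitions using (DecidableEquality; Decidable; Symmetric; Irreflexive)
open import Relation.Binary.PropositionalEquality using (_≡_; _≢_; refl)
open import Relation.Nullary using (¬_; Dec)
open import Relation.Nullary.Decidable using (via-injection; map′; ¬?; _×-dec_; _⊎-dec_; _→-dec_)
import Relation.Unary as Unary

-- The vertex set is nonempty, as is needed for the minimum degree to exist.
-- `inhabited` and `finite` are used only through notions that do not depend
-- on the choice of base vertex or of enumeration.
record Graph : Set₁ where
  field
    V         : Set
    inhabited : V
    order     : ℕ
    finite    : V ↔ Fin order
    Adj       : V → V → Set
    adj?      : Decidable Adj
    symmetric : Symmetric Adj
    loopless  : Irreflexive _≡_ Adj

  index : V → Fin order
  index = Inverse.to finite

  _≟_ : DecidableEquality V
  _≟_ = via-injection (↔⇒↣ finite) Fin._≟_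

  vertices : List V
  vertices = map (Inverse.from finite) (allFin order)

  N : V → List V
  N v = filter (adj? v) vertices

  degree : V → ℕ
  degree v = length (N v)

  -- An undirected edge is represented by the unique ordering of its two ends
  -- that is increasing in the enumeration, so `edges` lists every edge
  -- exactly once and distinct edges are unequal pairs.
  IsEdge : V × V → Set
  IsEdge (u , v) = index u Fin.< index v × Adj u v

  isEdge? : Unary.Decidable IsEdge
  isEdge? (u , v) = (index u Fin.<? index v) ×-dec adj? u v

  edges : List (V × V)
  edges = filter isEdge? (cartesianProduct vertices vertices)

  _≟ᴱ_ : DecidableEquality (V × V)
  _≟ᴱ_ = ≡-dec _≟_ _≟_

  EndOf : V × V → V → Set
  EndOf (u , v) w = w ≡ u ⊎ w ≡ v

  Joins : V × V → V × V → V × V → Set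
  Joins (u , v) e₁ e₂ = (EndOf e₁ u × EndOf e₂ v) ⊎ (EndOf e₁ v × EndOf e₂ u)

  IsEOP : List (V × V) → Set
  IsEOP B = ∀ {e₁ e₂} → e₁ ∈ B → e₂ ∈ B → e₁ ≢ e₂ →
            ∀ {e} → e ∈ edges → e ≢ e₁ → e ≢ e₂ → ¬ Joins e e₁ e₂

  IsOpenPacking : List V → Set
  IsOpenPacking P = ∀ {u v} → u ∈ P → v ∈ P → u ≢ v → Disjoint (N u) (N v)

  endOf? : ∀ e w → Dec (EndOf e w)
  endOf? (u , v) w = (w ≟ u) ⊎-dec (w ≟ v)

  joins? : ∀ e e₁ e₂ → Dec (Joins e e₁ e₂)
  joins? (u , v) e₁ e₂ = (endOf? e₁ u ×-dec endOf? e₂ v) ⊎-dec (endOf? e₁ v ×-dec endOf? e₂ u)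

  isEOP? : Unary.Decidable IsEOP
  isEOP? B = map′
    (λ all {_} {_} p q ne r → lookup (lookup (lookup all p) q ne) r)
    (λ eop → tabulate λ p → tabulate λ q ne → tabulate λ r → eop p q ne r)
    (all? (λ e₁ → all? (λ e₂ → ¬? (e₁ ≟ᴱ e₂) →-dec
      all? (λ e → ¬? (e ≟ᴱ e₁) →-dec (¬? (e ≟ᴱ e₂) →-dec ¬? (joins? e e₁ e₂))) edges) B) B)

  isOpenPacking? : Unary.Decidable IsOpenPacking
  isOpenPacking? P = map′
    (λ (all : All (λ u → All (λ v → u ≢ v → Disjoint (N u) (N v)) P) P)
      {_} {_} p q ne → lookup (lookup all p) q ne)
    (λ op → tabulate λ p → tabulate λ q ne → op p q ne)
    (all? (λ u → all? (λ v → ¬? (u ≟ v) →-dec DecDisjoint.disjoint? _≟_ (N u) (N v)) P) P)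

open Graph using (inhabited; vertices; edges; degree; isEOP?; isOpenPacking?)

-- For a list without repetitions, these are its subsets, each listed once,
-- and the length of each is its cardinality.
subsets : {A : Set} → List A → List (List A)
subsets []       = [] ∷ []
subsets (x ∷ xs) = map (x ∷_) (subsets xs) ++ subsets xs

-- The default value 0 of `max` is harmless for predicates that, like the two
-- below, hold of the empty set.
maxCardinality : {A : Set} {P : List A → Set} → Unary.Decidable P → List A → ℕ
maxCardinality P? xs = max 0 (map length (filter P? (subsets xs)))

ρₑᵒ : Graph → ℕ
ρₑᵒ G = maxCardinality (isEOP? G) (edges G)

ρᵒ : Graph → ℕ
ρᵒ G = maxCardinality (isOpenPacking? G) (vertices G)

δ : Graph → ℕ
δ G = min (degree G (inhabited G)) (map (degree G) (vertices G))

infixl 7 _×ᵍ_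

_×ᵍ_ : Graph → Graph → Graph
G ×ᵍ H = record
  { V         = G.V × H.V
  ; inhabited = G.inhabited , H.inhabited
  ; order     = G.order * H.order
  ; finite    = ↔-sym Fin.*↔× ↔-∘ (G.finite ×-↔ H.finite)
  ; Adj       = λ (g , h) (g′ , h′) → G.Adj g g′ × H.Adj h h′
  ; adj?      = λ (g , h) (g′ , h′) → G.adj? g g′ ×-dec H.adj? h h′
  ; symmetric = λ (a , b) → G.symmetric a , H.symmetric b
  ; loopless  = λ { refl (a , _) → G.loopless refl a }
  }
  where
  module G = Graph G
  module H = Graph H

{-# OPTIONS --safe #-}

-- Given an EOP set B of G, orient every edge of B from a centre c to a leaf l
-- in such a way that l lies on no other edge of B: B is a union of induced
-- stars with no edges between them. For an open packing P of H, the edges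
-- (c , h)(l , h′) with h ∈ P and h′ ∈ N h form an EOP set of G × H: an edge of
-- G × H between two of them projects in G to an edge from the centre to a leaf
-- of a single star, and in H it forces the two elements of P to coincide.
module Submission where

open import Defs
open import Data.Bool using (true; false)
open import Data.Fin as Fin using (Fin; zero; suc)
import Data.Fin.Properties as Fin
open import Data.List using (List; []; _∷_; _++_; map; filter; length; lookup; allFin; cartesianProduct)
open import Data.List.Extrema.Nat using (argmax-sel; xs≤max; min≤xs)
open import Data.List.Membership.Propositional using (_∈_; find; lose)
open import Data.List.Membership.Propositional.Properties
  using (∈-lookup; ∈-allFin; ∈-++⁺ˡ; ∈-++⁺ʳ; ∈-++⁻; ∈-map⁺; ∈-map⁻;
         ∈-filter⁺; ∈-filter⁻; ∈-cartesianProduct⁺; ∈-cartesianProduct⁻)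
open import Data.List.Membership.Setoid.Properties using (index-injective)
import Data.List.Membership.DecPropositional as DecMembership
open import Data.List.Properties using (length-map; length-++; filter-++)
open import Data.List.Relation.Unary.All as All using (_∷_)
open import Data.List.Relation.Unary.AllPairs using ([]; _∷_)
open import Data.List.Relation.Unary.Any as Any using (here; there; any?)
open import Data.List.Relation.Unary.Unique.Propositional using (Unique)
import Data.List.Relation.Unary.Unique.Propositional.Properties as Unique
open import Data.Nat using (ℕ; _+_; _≤_; _≥_; _*_; _⊔_)
import Data.Nat.Properties as ℕ
open import Data.Product using (_×_; _,_; ∃₂; ∃-syntax; proj₁; proj₂; swap; uncurry)
open import Data.Sum using (_⊎_; inj₁; inj₂; [_,_]′)
open import Function using (_∘_; id; Inverse; Injection)
open import Function.Construct.Identity using (↔-id)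
open import Function.Construct.Symmetry using (↔-sym)
open import Function.Properties.Inverse using (↔⇒↣)
open import Relation.Binary.Definitions using (tri<; tri≈; tri>)
open import Relation.Binary.PropositionalEquality
open import Relation.Nullary using (yes; no; does)
open import Relation.Nullary.Decidable using (¬?; _×-dec_; decidable-stable)
open import Relation.Nullary.Negation using (contradiction)
import Relation.Unary as Unary

-- Counting in lists; subsets and maximum cardinalities.

lookup-injective : {A : Set} {xs : List A} → Unique xs → ∀ {i j} → lookup xs i ≡ lookup xs j → i ≡ j
lookup-injective (x∉ ∷ u) {zero}  {zero}  eq = refl
lookup-injective (x∉ ∷ u) {zero}  {suc j} eq = contradiction eq (All.lookup x∉ (∈-lookup j))
lookup-injective (x∉ ∷ u) {suc i} {zero}  eq = contradiction (sym eq) (All.lookup x∉ (∈-lookup i))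
lookup-injective (x∉ ∷ u) {suc i} {suc j} eq = cong suc (lookup-injective u eq)

-- Pigeonhole on positions: a position in `xs` goes to the position in `ys` at which `into` locates
-- the image of its entry.
length-≤-injection : {A C : Set} {xs : List A} {ys : List C} (f : A → C) → Unique xs →
  (∀ {x} → x ∈ xs → f x ∈ ys) →
  (∀ {x y} → x ∈ xs → y ∈ xs → f x ≡ f y → x ≡ y) →
  length xs ≤ length ys
length-≤-injection {xs = xs} f u into inj = Fin.injective⇒≤ {f = λ i → Any.index (into (∈-lookup {xs = xs} i))}
  λ {i} {j} eq → lookup-injective u (inj (∈-lookup i) (∈-lookup j)
    (index-injective (setoid _) (into (∈-lookup {xs = xs} i)) (into (∈-lookup {xs = xs} j)) eq))

[]∈subsets : {A : Set} (xs : List A) → [] ∈ subsets xs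
[]∈subsets []       = here refl
[]∈subsets (x ∷ xs) = ∈-++⁺ʳ (map (x ∷_) (subsets xs)) ([]∈subsets xs)

∈-subsets⇒⊆ : {A : Set} (xs : List A) {ys : List A} → ys ∈ subsets xs → ∀ {y} → y ∈ ys → y ∈ xs
∈-subsets⇒⊆ []       (here refl) ()
∈-subsets⇒⊆ (x ∷ xs) ys∈ y∈ with ∈-++⁻ (map (x ∷_) (subsets xs)) ys∈
... | inj₂ ys∈′ = there (∈-subsets⇒⊆ xs ys∈′ y∈)
... | inj₁ ys∈′ with ∈-map⁻ (x ∷_) ys∈′ | y∈
...   | _ , zs∈ , refl | here refl = here refl
...   | _ , zs∈ , refl | there y∈′ = there (∈-subsets⇒⊆ xs zs∈ y∈′)

∈-subsets⇒Unique : {A : Set} {xs : List A} → Unique xs → {ys : List A} → ys ∈ subsets xs → Unique ys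
∈-subsets⇒Unique {xs = []}     []       (here refl) = []
∈-subsets⇒Unique {xs = x ∷ xs} (x∉ ∷ u) ys∈ with ∈-++⁻ (map (x ∷_) (subsets xs)) ys∈
... | inj₂ ys∈′ = ∈-subsets⇒Unique u ys∈′
... | inj₁ ys∈′ with ∈-map⁻ (x ∷_) ys∈′
...   | _ , zs∈ , refl = All.tabulate (λ z∈ → All.lookup x∉ (∈-subsets⇒⊆ xs zs∈ z∈)) ∷ ∈-subsets⇒Unique u zs∈

filter∈subsets : {A : Set} {P : A → Set} (P? : Unary.Decidable P) (xs : List A) → filter P? xs ∈ subsets xs
filter∈subsets P? [] = here refl
filter∈subsets P? (x ∷ xs) with does (P? x)
... | true  = ∈-++⁺ˡ (∈-map⁺ (x ∷_) (filter∈subsets P? xs))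
... | false = ∈-++⁺ʳ (map (x ∷_) (subsets xs)) (filter∈subsets P? xs)

module _ {A : Set} {P : List A → Set} (P? : Unary.Decidable P) (xs : List A) where

  private
    lengths : List ℕ
    lengths = map length (filter P? (subsets xs))

  maxCardinality-attained : P [] → ∃[ ys ] ys ∈ subsets xs × P ys × maxCardinality P? xs ≡ length ys
  maxCardinality-attained p[] with argmax-sel id 0 lengths
  -- The maximum is the default value 0 of `max`; the empty set attains it.
  ... | inj₁ eq = [] , []∈subsets xs , p[] , eq
  ... | inj₂ m∈ with ∈-map⁻ length m∈
  ...   | ys , ys∈ , eq with ∈-filter⁻ P? {xs = subsets xs} ys∈
  ...     | ys∈′ , p = ys , ys∈′ , p , eq

  length≤maxCardinality : ∀ {ys} → ys ∈ subsets xs → P ys → length ys ≤ maxCardinality P? xs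
  length≤maxCardinality ys∈ p = All.lookup (xs≤max 0 lengths) (∈-map⁺ length (∈-filter⁺ P? ys∈ p))

length-filter-map : {A C : Set} {P : C → Set} (P? : Unary.Decidable P) (f : A → C) (xs : List A) →
  length (filter P? (map f xs)) ≡ length (filter (P? ∘ f) xs)
length-filter-map P? f [] = refl
length-filter-map P? f (x ∷ xs) with does (P? (f x))
... | true  = cong (1 +_) (length-filter-map P? f xs)
... | false = length-filter-map P? f xs

length-cartesianProduct : {A C : Set} (xs : List A) (ys : List C) →
  length (cartesianProduct xs ys) ≡ length xs * length ys
length-cartesianProduct [] ys = refl
length-cartesianProduct (x ∷ xs) ys = begin
  length (map (x ,_) ys ++ cartesianProduct xs ys)
    ≡⟨ length-++ (map (x ,_) ys) ⟩
  length (map (x ,_) ys) + length (cartesianProduct xs ys)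
    ≡⟨ cong₂ _+_ (length-map (x ,_) ys) (length-cartesianProduct xs ys) ⟩
  length ys + length xs * length ys ∎
  where open ≡-Reasoning

-- Neighbourhoods, darts, and edges given by their two ends.

module GraphProperties (G : Graph) where
  open Graph G public

  ∈-vertices : ∀ v → v ∈ vertices
  ∈-vertices v = subst (_∈ vertices) (Inverse.strictlyInverseʳ finite v)
    (∈-map⁺ (Inverse.from finite) (∈-allFin (index v)))

  vertices-Unique : Unique vertices
  vertices-Unique = Unique.map⁺ (Injection.injective (↔⇒↣ (↔-sym finite))) (Unique.allFin⁺ order)

  index-inj : ∀ {u v} → index u ≡ index v → u ≡ v
  index-inj = Injection.injective (↔⇒↣ finite)

  edges-Unique : Unique edges
  edges-Unique = Unique.filter⁺ isEdge? (Unique.cartesianProduct⁺ vertices-Unique vertices-Unique)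

  ∈-edges⁺ : ∀ {e} → IsEdge e → e ∈ edges
  ∈-edges⁺ {u , v} = ∈-filter⁺ isEdge? (∈-cartesianProduct⁺ (∈-vertices u) (∈-vertices v))

  ∈-edges⁻ : ∀ {e} → e ∈ edges → IsEdge e
  ∈-edges⁻ e∈ = proj₂ (∈-filter⁻ isEdge? {xs = cartesianProduct vertices vertices} e∈)

  ∈-N⁺ : ∀ {u v} → Adj u v → v ∈ N u
  ∈-N⁺ {u} {v} = ∈-filter⁺ (adj? u) (∈-vertices v)

  δ≤degree : ∀ v → δ G ≤ degree v
  δ≤degree v = All.lookup (min≤xs (degree inhabited) (map degree vertices)) (∈-map⁺ degree (∈-vertices v))

  packing-coincide : ∀ {P} → IsOpenPacking P → ∀ {u v w} → u ∈ P → v ∈ P → Adj u w → Adj v w → u ≡ v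
  packing-coincide op {u} {v} u∈ v∈ uw vw =
    decidable-stable (u ≟ v) λ u≢v → op u∈ v∈ u≢v (∈-N⁺ uw , ∈-N⁺ vw)

  -- The arcs that start in `P`. An edge with both ends in `P` counts twice, once in each direction;
  -- an open packing may contain adjacent vertices, and the two arcs lift to different edges of the
  -- product.
  darts : List V → List (V × V)
  darts P = filter (uncurry adj?) (cartesianProduct P vertices)

  -- Grouped by first vertex, the darts number the sum of the degrees over `P`, and each degree is
  -- at least `δ G`.
  length-darts : ∀ P → δ G * length P ≤ length (darts P)
  length-darts [] = ℕ.≤-reflexive (ℕ.*-zeroʳ (δ G))
  length-darts (h ∷ P) = begin
    δ G * (1 + length P)                  ≡⟨ ℕ.*-suc (δ G) (length P) ⟩
    δ G + δ G * length P                    ≤⟨ ℕ.+-mono-≤ (δ≤degree h) (length-darts P) ⟩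
    degree h + length (darts P)             ≡⟨ cong (_+ length (darts P)) (length-filter-map (uncurry adj?) (h ,_) vertices) ⟨
    length (filter (uncurry adj?) (map (h ,_) vertices)) + length (darts P)
                                            ≡⟨ length-++ (filter (uncurry adj?) (map (h ,_) vertices)) ⟨
    length (filter (uncurry adj?) (map (h ,_) vertices) ++ darts P)
                                            ≡⟨ cong length (filter-++ (uncurry adj?) (map (h ,_) vertices) _) ⟨
    length (darts (h ∷ P))                  ∎
    where open ℕ.≤-Reasoning

  ∈-darts⁻ : ∀ P {h h′} → (h , h′) ∈ darts P → h ∈ P × Adj h h′
  ∈-darts⁻ P d∈ with ∈-filter⁻ (uncurry adj?) {xs = cartesianProduct P vertices} d∈
  ... | hh′∈ , a = proj₁ (∈-cartesianProduct⁻ P vertices hh′∈) , a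

  darts-Unique : ∀ {P} → Unique P → Unique (darts P)
  darts-Unique u = Unique.filter⁺ (uncurry adj?) (Unique.cartesianProduct⁺ u vertices-Unique)

  -- The representative in `edges` of the edge with ends `u` and `v`, for adjacent `u` and `v` in
  -- either order. The `no` branch also covers equal vertices, which `edge-IsEdge` excludes by
  -- looplessness.
  edge : V → V → V × V
  edge u v with index u Fin.<? index v
  ... | yes _ = u , v
  ... | no  _ = v , u

  edge-sel : ∀ u v → edge u v ≡ (u , v) ⊎ edge u v ≡ (v , u)
  edge-sel u v with index u Fin.<? index v
  ... | yes _ = inj₁ refl
  ... | no  _ = inj₂ refl

  edge-IsEdge : ∀ {u v} → Adj u v → IsEdge (edge u v)
  edge-IsEdge {u} {v} a with index u Fin.<? index v
  ... | yes u<v = u<v , a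
  ... | no  u≮v with Fin.<-cmp (index u) (index v)
  ...   | tri< u<v _ _ = contradiction u<v u≮v
  ...   | tri≈ _ u≡v _ = contradiction a (loopless (index-inj u≡v))
  ...   | tri> _ _ v<u = v<u , symmetric a

  EndOf-edgeˡ : ∀ u v → EndOf (edge u v) u
  EndOf-edgeˡ u v with edge-sel u v
  ... | inj₁ eq rewrite eq = inj₁ refl
  ... | inj₂ eq rewrite eq = inj₂ refl

  EndOf-edgeʳ : ∀ u v → EndOf (edge u v) v
  EndOf-edgeʳ u v with edge-sel u v
  ... | inj₁ eq rewrite eq = inj₂ refl
  ... | inj₂ eq rewrite eq = inj₁ refl

  EndOf-edge⁻ : ∀ u v {w} → EndOf (edge u v) w → w ≡ u ⊎ w ≡ v
  EndOf-edge⁻ u v w∈ with edge-sel u v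
  ... | inj₁ eq rewrite eq = w∈
  ... | inj₂ eq rewrite eq = [ inj₂ , inj₁ ]′ w∈

  -- Adjacent vertices are distinct, so `u` and `v` are the two ends of `e` in one order or the
  -- other, and the enumeration settles which order is stored.
  edge≡ : ∀ {e u v} → IsEdge e → EndOf e u → EndOf e v → Adj u v → edge u v ≡ e
  edge≡ (u<v , _) (inj₁ refl) (inj₁ refl) a = contradiction a (loopless refl)
  edge≡ (u<v , _) (inj₂ refl) (inj₂ refl) a = contradiction a (loopless refl)
  edge≡ {u , v} (u<v , _) (inj₁ refl) (inj₂ refl) a with index u Fin.<? index v
  ... | yes _   = refl
  ... | no  u≮v = contradiction u<v u≮v
  edge≡ {u , v} (u<v , _) (inj₂ refl) (inj₁ refl) a with index v Fin.<? index u
  ... | yes v<u = contradiction v<u (Fin.<-asym u<v)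
  ... | no  _   = refl

  -- In contrast with IsEOP, the two edges e₁ and e₂ may be equal here.
  EOP⁻ : ∀ {B} → (∀ {e} → e ∈ B → e ∈ edges) → IsEOP B → ∀ {e₁ e₂ u v} → e₁ ∈ B → e₂ ∈ B →
    EndOf e₁ u → EndOf e₂ v → Adj u v → edge u v ≡ e₁ ⊎ edge u v ≡ e₂
  EOP⁻ B⊆ eop {e₁} {e₂} {u} {v} p q u∈ v∈ a with edge u v ≟ᴱ e₁ | edge u v ≟ᴱ e₂ | e₁ ≟ᴱ e₂
  ... | yes eq | _      | _        = inj₁ eq
  ... | _      | yes eq | _        = inj₂ eq
  ... | _      | _      | yes refl = inj₁ (edge≡ (∈-edges⁻ (B⊆ p)) u∈ v∈ a)
  ... | no ≢₁  | no ≢₂  | no e₁≢e₂ =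
    contradiction joins (eop p q e₁≢e₂ (∈-edges⁺ (edge-IsEdge a)) ≢₁ ≢₂)
    where
    joins : Joins (edge u v) e₁ e₂
    joins with edge-sel u v
    ... | inj₁ eq rewrite eq = inj₁ (u∈ , v∈)
    ... | inj₂ eq rewrite eq = inj₂ (u∈ , v∈)

  -- A converse to `EOP⁻`. By `edge≡`, a joining edge is `edge` of its own ends in either order, so
  -- the hypothesis applies to the ends in the order in which they meet `e₁` and `e₂`.
  EOP⁺ : ∀ {B} → (∀ {e₁ e₂ u v} → e₁ ∈ B → e₂ ∈ B →
    EndOf e₁ u → EndOf e₂ v → Adj u v → edge u v ≡ e₁ ⊎ edge u v ≡ e₂) → IsEOP B
  EOP⁺ closed p q _ {u , v} e∈ ≢₁ ≢₂ joins = [ ≢₁ , ≢₂ ]′ (e≡ joins)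
    where
    isEdge = ∈-edges⁻ e∈
    e≡ : Joins (u , v) _ _ → (u , v) ≡ _ ⊎ (u , v) ≡ _
    e≡ (inj₁ (u∈ , v∈)) = subst (λ e → e ≡ _ ⊎ e ≡ _)
      (edge≡ isEdge (inj₁ refl) (inj₂ refl) (proj₂ isEdge)) (closed p q u∈ v∈ (proj₂ isEdge))
    e≡ (inj₂ (v∈ , u∈)) = subst (λ e → e ≡ _ ⊎ e ≡ _)
      (edge≡ isEdge (inj₂ refl) (inj₁ refl) (symmetric (proj₂ isEdge))) (closed p q v∈ u∈ (symmetric (proj₂ isEdge)))

-- The star structure of an EOP set.

module Stars (G : Graph) {B : List (Graph.V G × Graph.V G)}
  (B⊆ : ∀ {e} → e ∈ B → e ∈ Graph.edges G) (eop : Graph.IsEOP G B) where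

  open GraphProperties G

  -- The result is the pair (centre, leaf). The second stored end serves as leaf unless another edge
  -- of `B` contains it. An edge of `B` that meets no other keeps its stored order, so its centre is
  -- an arbitrary choice.
  orient : V × V → V × V
  orient e with any? (λ e′ → ¬? (e′ ≟ᴱ e) ×-dec endOf? e′ (proj₂ e)) B
  ... | yes _ = swap e
  ... | no  _ = e

  centre leaf : V × V → V
  centre = proj₁ ∘ orient
  leaf   = proj₂ ∘ orient

  orient-sel : ∀ e → orient e ≡ e ⊎ orient e ≡ swap e
  orient-sel e with any? (λ e′ → ¬? (e′ ≟ᴱ e) ×-dec endOf? e′ (proj₂ e)) B
  ... | yes _ = inj₂ refl
  ... | no  _ = inj₁ refl

  centre∈ : ∀ e → EndOf e (centre e)
  centre∈ e with orient-sel e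
  ... | inj₁ eq rewrite eq = inj₁ refl
  ... | inj₂ eq rewrite eq = inj₂ refl

  leaf∈ : ∀ e → EndOf e (leaf e)
  leaf∈ e with orient-sel e
  ... | inj₁ eq rewrite eq = inj₂ refl
  ... | inj₂ eq rewrite eq = inj₁ refl

  EndOf⇒centre⊎leaf : ∀ e {w} → EndOf e w → w ≡ centre e ⊎ w ≡ leaf e
  EndOf⇒centre⊎leaf e w∈ with orient-sel e
  ... | inj₁ eq rewrite eq = w∈
  ... | inj₂ eq rewrite eq = [ inj₂ , inj₁ ]′ w∈

  centre-leaf-Adj : ∀ {e} → e ∈ B → Adj (centre e) (leaf e)
  centre-leaf-Adj {e} e∈ with orient-sel e
  ... | inj₁ eq rewrite eq = proj₂ (∈-edges⁻ (B⊆ e∈))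
  ... | inj₂ eq rewrite eq = symmetric (proj₂ (∈-edges⁻ (B⊆ e∈)))

  -- If both ends of e were shared, by e′ and e₃, then e would join e′ and e₃.
  leaf-private : ∀ {e e′} → e ∈ B → e′ ∈ B → EndOf e′ (leaf e) → e′ ≡ e
  leaf-private {e} {e′} e∈ e′∈ l∈e′ with any? (λ e₃ → ¬? (e₃ ≟ᴱ e) ×-dec endOf? e₃ (proj₂ e)) B
  ... | no ¬shared = decidable-stable (e′ ≟ᴱ e) λ e′≢e → ¬shared (lose e′∈ (e′≢e , l∈e′))
  ... | yes shared with find shared
  ...   | e₃ , e₃∈ , e₃≢e , c∈e₃ =
    trans (sym edge≡e′) edge≡e
    where
    a = proj₂ (∈-edges⁻ (B⊆ e∈))
    edge≡e = edge≡ (∈-edges⁻ (B⊆ e∈)) (inj₁ refl) (inj₂ refl) a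
    edge≡e′ : edge (proj₁ e) (proj₂ e) ≡ e′
    edge≡e′ with EOP⁻ B⊆ eop e′∈ e₃∈ l∈e′ c∈e₃ a
    ... | inj₁ eq = eq
    ... | inj₂ eq = contradiction (trans (sym eq) edge≡e) e₃≢e

  -- Otherwise `e` would contain the leaf of `e′`, hence equal `e′` by privacy, and its two ends
  -- would coincide.
  centre≢leaf : ∀ {e e′} → e ∈ B → e′ ∈ B → centre e ≢ leaf e′
  centre≢leaf {e} {e′} e∈ e′∈ eq with leaf-private e′∈ e∈ (subst (EndOf e) eq (centre∈ e))
  ... | refl = loopless eq (centre-leaf-Adj e∈)

  private
    -- The case where `u` and `v` are both ends of `e₂`, so that `e₁` and `e₂` share `u`. If `u` is
    -- the leaf of `e₂`, privacy gives equal edges; if it is the centre of `e₂`, then `centre≢leaf`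
    -- makes it the centre of `e₁` too.
    star-edge′ : ∀ {e₁ e₂ u v} → e₁ ∈ B → e₂ ∈ B → EndOf e₁ u → EndOf e₂ u → EndOf e₂ v → Adj u v →
      centre e₁ ≡ centre e₂ × ((u ≡ centre e₁ × v ≡ leaf e₂) ⊎ (u ≡ leaf e₁ × v ≡ centre e₂))
    star-edge′ {e₁} {e₂} p q u∈₁ u∈₂ v∈₂ a with EndOf⇒centre⊎leaf e₂ u∈₂ | EndOf⇒centre⊎leaf e₂ v∈₂
    ... | inj₁ u≡c | inj₁ v≡c = contradiction a (loopless (trans u≡c (sym v≡c)))
    ... | inj₂ u≡l | inj₂ v≡l = contradiction a (loopless (trans u≡l (sym v≡l)))
    ... | inj₂ u≡l | inj₁ v≡c with leaf-private q p (subst (EndOf e₁) u≡l u∈₁)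
    ...   | refl = refl , inj₂ (u≡l , v≡c)
    star-edge′ {e₁} {e₂} p q u∈₁ u∈₂ v∈₂ a | inj₁ u≡c | inj₂ v≡l with EndOf⇒centre⊎leaf e₁ u∈₁
    ... | inj₁ u≡c₁ = trans (sym u≡c₁) u≡c , inj₁ (u≡c₁ , v≡l)
    ... | inj₂ u≡l₁ = contradiction (trans (sym u≡c) u≡l₁) (centre≢leaf q p)

  -- By `EOP⁻` the edge between `u` and `v` is `e₁` or `e₂`. The case `e₂` is `star-edge′`; the case
  -- `e₁` follows from it on exchanging both the edges and the vertices.
  star-edge : ∀ {e₁ e₂ u v} → e₁ ∈ B → e₂ ∈ B → EndOf e₁ u → EndOf e₂ v → Adj u v →
    centre e₁ ≡ centre e₂ × ((u ≡ centre e₁ × v ≡ leaf e₂) ⊎ (u ≡ leaf e₁ × v ≡ centre e₂))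
  star-edge {u = u} {v} p q u∈ v∈ a with EOP⁻ B⊆ eop p q u∈ v∈ a
  ... | inj₂ eq = star-edge′ p q u∈ (subst (λ e → EndOf e u) eq (EndOf-edgeˡ u v)) v∈ a
  ... | inj₁ eq with star-edge′ q p v∈ (subst (λ e → EndOf e v) eq (EndOf-edgeʳ u v)) u∈ (symmetric a)
  ...   | c≡ , inj₁ (v≡c , u≡l) = sym c≡ , inj₂ (u≡l , v≡c)
  ...   | c≡ , inj₂ (v≡l , u≡c) = sym c≡ , inj₁ (u≡c , v≡l)

-- Lifting an EOP set along an open packing.

open Graph using (V; Adj; edges; vertices; symmetric; EndOf; IsEOP; IsOpenPacking; isEOP?; isOpenPacking?; _≟ᴱ_)

-- K stands for either of G ×ᵍ H and H ×ᵍ G.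
module Embedding (G H K : Graph)
  (⟨_,_⟩ : V G → V H → V K)
  (⟨,⟩-injective : ∀ {g h g′ h′} → ⟨ g , h ⟩ ≡ ⟨ g′ , h′ ⟩ → g ≡ g′ × h ≡ h′)
  (⟨,⟩-Adj⁺ : ∀ {g h g′ h′} → Adj G g g′ → Adj H h h′ → Adj K ⟨ g , h ⟩ ⟨ g′ , h′ ⟩)
  (⟨,⟩-Adj⁻ : ∀ {g h g′ h′} → Adj K ⟨ g , h ⟩ ⟨ g′ , h′ ⟩ → Adj G g g′ × Adj H h h′)
  where

  private
    module G = GraphProperties G
    module H = GraphProperties H
    module K = GraphProperties K

  module _ {B : List (V G × V G)} (B⊆ : ∀ {e} → e ∈ B → e ∈ edges G) (eop : IsEOP G B) (B! : Unique B)
    {P : List (V H)} (packing : IsOpenPacking H P) (P! : Unique P) where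

    open Stars G B⊆ eop

    Index : Set
    Index = (V G × V G) × (V H × V H)

    indices : List Index
    indices = cartesianProduct B (H.darts P)

    tail head : Index → V K
    tail (e , h , h′) = ⟨ centre e , h ⟩
    head (e , h , h′) = ⟨ leaf e , h′ ⟩

    lift : Index → V K × V K
    lift t = K.edge (tail t) (head t)

    ∈-indices⁻ : ∀ {e h h′} → (e , h , h′) ∈ indices → e ∈ B × h ∈ P × Adj H h h′
    ∈-indices⁻ t∈ with ∈-cartesianProduct⁻ B (H.darts P) t∈
    ... | e∈ , d∈ = e∈ , H.∈-darts⁻ P d∈

    tail-head-Adj : ∀ {t} → t ∈ indices → Adj K (tail t) (head t)
    tail-head-Adj t∈ with ∈-indices⁻ t∈
    ... | e∈ , _ , hh′ = ⟨,⟩-Adj⁺ (centre-leaf-Adj e∈) hh′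

    lift∈edges : ∀ {t} → t ∈ indices → lift t ∈ edges K
    lift∈edges t∈ = K.∈-edges⁺ (K.edge-IsEdge (tail-head-Adj t∈))

    -- Tails lie over centres and heads over leaves, so equal lifts match tail with tail and head
    -- with head. This gives the dart at once, and the edge of `B` because its leaf is private.
    lift-injective : ∀ {t₁ t₂} → t₁ ∈ indices → t₂ ∈ indices → lift t₁ ≡ lift t₂ → t₁ ≡ t₂
    lift-injective {t₁@(e₁ , h , h′)} {t₂@(e₂ , k , k′)} t₁∈ t₂∈ eq
      with ∈-indices⁻ t₁∈ | ∈-indices⁻ t₂∈
         | K.EndOf-edge⁻ (tail t₂) (head t₂) (subst (λ e → EndOf K e (tail t₁)) eq (K.EndOf-edgeˡ (tail t₁) (head t₁)))
         | K.EndOf-edge⁻ (tail t₂) (head t₂) (subst (λ e → EndOf K e (head t₁)) eq (K.EndOf-edgeʳ (tail t₁) (head t₁)))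
    ... | e₁∈ , _ | e₂∈ , _ | inj₂ tail≡ | _ = contradiction (proj₁ (⟨,⟩-injective tail≡)) (centre≢leaf e₁∈ e₂∈)
    ... | e₁∈ , _ | e₂∈ , _ | _ | inj₁ head≡ = contradiction (sym (proj₁ (⟨,⟩-injective head≡))) (centre≢leaf e₂∈ e₁∈)
    ... | e₁∈ , _ | e₂∈ , _ | inj₁ tail≡ | inj₂ head≡ with ⟨,⟩-injective tail≡ | ⟨,⟩-injective head≡
    ...   | _ , refl | l≡ , refl with leaf-private e₂∈ e₁∈ (subst (EndOf G e₁) l≡ (leaf∈ e₁))
    ...     | refl = refl

    -- Two tails, or two heads, are never adjacent, since by `star-edge` the projection to `G` runs
    -- between a centre and a leaf. If one vertex is a tail and the other a head, the centres agree
    -- and the packing gives `h = k`, so the edge is the lift that owns the head.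
    lift-closed : ∀ {t₁ t₂ u v} → t₁ ∈ indices → t₂ ∈ indices →
      EndOf K (lift t₁) u → EndOf K (lift t₂) v → Adj K u v → K.edge u v ≡ lift t₁ ⊎ K.edge u v ≡ lift t₂
    lift-closed {t₁@(e₁ , h , h′)} {t₂@(e₂ , k , k′)} t₁∈ t₂∈ u∈ v∈ a
      with ∈-indices⁻ t₁∈ | ∈-indices⁻ t₂∈
         | K.EndOf-edge⁻ (tail t₁) (head t₁) u∈ | K.EndOf-edge⁻ (tail t₂) (head t₂) v∈
    ... | e₁∈ , h∈ , hh′ | e₂∈ , k∈ , kk′ | inj₁ refl | inj₁ refl
      with star-edge e₁∈ e₂∈ (centre∈ e₁) (centre∈ e₂) (proj₁ (⟨,⟩-Adj⁻ a))
    ...   | _ , inj₁ (_ , c≡l) = contradiction c≡l (centre≢leaf e₂∈ e₂∈)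
    ...   | _ , inj₂ (c≡l , _) = contradiction c≡l (centre≢leaf e₁∈ e₁∈)
    lift-closed {t₁@(e₁ , h , h′)} {t₂@(e₂ , k , k′)} t₁∈ t₂∈ u∈ v∈ a
        | e₁∈ , h∈ , hh′ | e₂∈ , k∈ , kk′ | inj₂ refl | inj₂ refl
      with star-edge e₁∈ e₂∈ (leaf∈ e₁) (leaf∈ e₂) (proj₁ (⟨,⟩-Adj⁻ a))
    ...   | _ , inj₁ (l≡c , _) = contradiction (sym l≡c) (centre≢leaf e₁∈ e₁∈)
    ...   | _ , inj₂ (_ , l≡c) = contradiction (sym l≡c) (centre≢leaf e₂∈ e₂∈)
    lift-closed {t₁@(e₁ , h , h′)} {t₂@(e₂ , k , k′)} t₁∈ t₂∈ u∈ v∈ a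
        | e₁∈ , h∈ , hh′ | e₂∈ , k∈ , kk′ | inj₁ refl | inj₂ refl
      -- `k′` is a common neighbour of `h` and `k`.
      with star-edge e₁∈ e₂∈ (centre∈ e₁) (leaf∈ e₂) (proj₁ (⟨,⟩-Adj⁻ a))
         | H.packing-coincide packing h∈ k∈ (proj₂ (⟨,⟩-Adj⁻ a)) kk′
    ...   | c≡ , _ | refl = inj₂ (cong (λ c → K.edge ⟨ c , h ⟩ (head t₂)) c≡)
    lift-closed {t₁@(e₁ , h , h′)} {t₂@(e₂ , k , k′)} t₁∈ t₂∈ u∈ v∈ a
        | e₁∈ , h∈ , hh′ | e₂∈ , k∈ , kk′ | inj₂ refl | inj₁ refl
      -- `h′` is now the common neighbour. The vertices come as head, then tail, the reverse of the
      -- order in `lift`, hence the use of `edge≡`.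
      with star-edge e₁∈ e₂∈ (leaf∈ e₁) (centre∈ e₂) (proj₁ (⟨,⟩-Adj⁻ a))
         | H.packing-coincide packing h∈ k∈ hh′ (symmetric H (proj₂ (⟨,⟩-Adj⁻ a)))
    ...   | c≡ , _ | refl = inj₁ (K.edge≡ (K.edge-IsEdge (tail-head-Adj t₁∈)) (K.EndOf-edgeʳ (tail t₁) (head t₁))
              (subst (λ c → EndOf K (lift t₁) ⟨ c , k ⟩) c≡ (K.EndOf-edgeˡ (tail t₁) (head t₁))) a)

    open DecMembership (_≟ᴱ_ K) using (_∈?_)

    -- A filter of `edges K` rather than `map lift indices`, because `subsets (edges K)` lists each
    -- subset only in the order of `edges K`.
    liftedEdges : List (V K × V K)
    liftedEdges = filter (_∈? map lift indices) (edges K)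

    ∈-liftedEdges⁻ : ∀ {e} → e ∈ liftedEdges → ∃[ t ] t ∈ indices × e ≡ lift t
    ∈-liftedEdges⁻ e∈ = ∈-map⁻ lift (proj₂ (∈-filter⁻ (_∈? map lift indices) {xs = edges K} e∈))

    liftedEdges-EOP : IsEOP K liftedEdges
    liftedEdges-EOP = K.EOP⁺ closed
      where
      closed : ∀ {e₁ e₂ u v} → e₁ ∈ liftedEdges → e₂ ∈ liftedEdges →
        EndOf K e₁ u → EndOf K e₂ v → Adj K u v → K.edge u v ≡ e₁ ⊎ K.edge u v ≡ e₂
      closed p q with ∈-liftedEdges⁻ p | ∈-liftedEdges⁻ q
      ... | _ , t₁∈ , refl | _ , t₂∈ , refl = lift-closed t₁∈ t₂∈

    indices≤ρₑᵒ : length indices ≤ ρₑᵒ K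
    indices≤ρₑᵒ = ℕ.≤-trans
      (length-≤-injection lift (Unique.cartesianProduct⁺ B! (H.darts-Unique P!))
        (λ t∈ → ∈-filter⁺ (_∈? map lift indices) (lift∈edges t∈) (∈-map⁺ lift t∈))
        lift-injective)
      (length≤maxCardinality (isEOP? K) (edges K) (filter∈subsets (_∈? map lift indices) (edges K)) liftedEdges-EOP)

  ρₑᵒ-lower-bound : ρₑᵒ G * δ H * ρᵒ H ≤ ρₑᵒ K
  ρₑᵒ-lower-bound
    -- `B` is a maximum EOP set and `P` a maximum open packing; the empty set has both properties
    -- vacuously.
    with maxCardinality-attained (isEOP? G) (edges G) (λ ())
       | maxCardinality-attained (isOpenPacking? H) (vertices H) (λ ())
  ... | B , B∈ , eop , ρₑᵒ≡ | P , P∈ , packing , ρᵒ≡ = begin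
    ρₑᵒ G * δ H * ρᵒ H               ≡⟨ cong₂ (λ b p → b * δ H * p) ρₑᵒ≡ ρᵒ≡ ⟩
    length B * δ H * length P        ≡⟨ ℕ.*-assoc (length B) (δ H) (length P) ⟩
    length B * (δ H * length P)      ≤⟨ ℕ.*-monoʳ-≤ (length B) (H.length-darts P) ⟩
    length B * length (H.darts P)    ≡⟨ length-cartesianProduct B (H.darts P) ⟨
    length (cartesianProduct B (H.darts P))
      ≤⟨ indices≤ρₑᵒ (∈-subsets⇒⊆ (edges G) B∈) eop (∈-subsets⇒Unique G.edges-Unique B∈)
           packing (∈-subsets⇒Unique H.vertices-Unique P∈) ⟩
    ρₑᵒ K                            ∎
    where open ℕ.≤-Reasoning

-- Sharpness, and the two bounds combined.

K₂ : Graph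
K₂ = record
  { V         = Fin 2
  ; inhabited = zero
  ; order     = 2
  ; finite    = ↔-id (Fin 2)
  ; Adj       = _≢_
  ; adj?      = λ u v → ¬? (u Fin.≟ v)
  ; symmetric = ≢-sym
  ; loopless  = λ u≡v u≢v → u≢v u≡v
  }

theorem4p2 : ((G H : Graph) →
    ρₑᵒ (G ×ᵍ H) ≥ (ρₑᵒ G * δ H * ρᵒ H) ⊔ (ρₑᵒ H * δ G * ρᵒ G))
    × (∃₂ λ (G H : Graph) →
    ρₑᵒ (G ×ᵍ H) ≡ (ρₑᵒ G * δ H * ρᵒ H) ⊔ (ρₑᵒ H * δ G * ρᵒ G))
theorem4p2 =
  (λ G H → ℕ.⊔-lub
    (Embedding.ρₑᵒ-lower-bound G H (G ×ᵍ H) _,_ (λ { refl → refl , refl }) _,_ id)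
    -- The flipped pairing embeds directly into `G ×ᵍ H`, so the isomorphism with `H ×ᵍ G` does not
    -- enter.
    (Embedding.ρₑᵒ-lower-bound H G (G ×ᵍ H) (λ h g → g , h) (λ { refl → refl , refl }) (λ hh′ gg′ → gg′ , hh′) swap))
  -- Both sides evaluate to 2. The product is two disjoint edges, which form an EOP set; for `K₂`
  -- itself `ρₑᵒ` and `δ` are 1, and `ρᵒ` is 2 since its two vertices have disjoint neighbourhoods.
  , K₂ , K₂ , refl
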